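{- Let $G$ be a connected graph with $\operatorname{diam}(G)\leq 2$. Then (i) $\mathrm{lec}(G)=1$ if $G=K_n$ for some $n\geq 2$; and (ii) otherwise $2\leq \mathrm{lec}(G)\leq \max\{3,\Delta(C(G))\}$. Moreover, all three bounds (the values $2$, $3$ and $\Delta(C(G))$) are attained.
   Context: Graphs are finite, simple, undirected. Given an edge-colouring $\varphi:E(G)\to[1,k]$, a path is loose if it consists of exactly one edge, or of exactly two edges of different colours, or has at least three edges coloured with at least three distinct colours. $\mathrm{lec}(G)$ is the least $k$ for which there is an edge-colouring with $k$ colours such that every two distinct vertices are joined by a loose path. The cut-edge graph $C(G)$ is the graph whose edges are the cut-edges (bridges) of $G$ and whose vertices are their endpoints; $\Delta(C(G))$ is its maximum degree ($0$ if $G$ has no cut-edges). -}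

module Defs where

open import Data.Nat using (ℕ; zero; suc; _≤_; _⊔_)
open import Data.Fin using (Fin)
open import Data.Bool using (Bool; true; false; T)
open import Data.List using (List; []; _∷_; _++_)
open import Data.List.Relation.Unary.All using (All; []; _∷_)
open import Data.List.Relation.Unary.Unique.Propositional using (Unique)
open import Data.List.Membership.Propositional using (_∈_)
open import Data.Product using (Σ; _×_; _,_; proj₁; proj₂; ∃)
open import Data.Sum using (_⊎_)
open import Data.Empty using (⊥)
open import Data.Unit using (⊤)
open import Relation.Nullary using (¬_)
open import Relation.Binary.PropositionalEquality using (_≡_; _≢_)
open import Function.Definitions using (Injective)

record Graph : Set where
  field
    n      : ℕ
    adj    : Fin n → Fin n → Bool
    sym    : ∀ u v → adj u v ≡ adj v u
    irrefl : ∀ v → adj v v ≡ false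

open Graph public

V : Graph → Set
V G = Fin (n G)

Adj : (G : Graph) → V G → V G → Set
Adj G u v = T (adj G u v)

pairs : {A : Set} → List A → List (A × A)
pairs (x ∷ y ∷ xs) = (x , y) ∷ pairs (y ∷ xs)
pairs _            = []

-- a u–v path: vertex sequence u, mid..., v, all distinct, consecutive
-- vertices adjacent (distinctness forces u ≢ v, so at least one edge)
record Path (G : Graph) (u v : V G) : Set where
  field
    mid    : List (V G)
  verts : List (V G)
  verts = u ∷ mid ++ v ∷ []
  field
    unique : Unique verts
    edges  : All (λ p → Adj G (proj₁ p) (proj₂ p)) (pairs verts)

Connected : Graph → Set
Connected G = ∀ (u v : V G) → u ≢ v → Path G u v

DiamAtMost2 : Graph → Set
DiamAtMost2 G = ∀ (u v : V G) →
  u ≡ v ⊎ Adj G u v ⊎ Σ (V G) (λ w → Adj G u w × Adj G w v)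

Complete : Graph → Set
Complete G = ∀ (u v : V G) → u ≢ v → Adj G u v

record EdgeColouring (G : Graph) (k : ℕ) : Set where
  field
    col    : (u v : V G) → Adj G u v → Fin k
    colSym : ∀ u v (e : Adj G u v) (e' : Adj G v u) → col u v e ≡ col v u e'

edgeColours : {G : Graph} {k : ℕ} → EdgeColouring G k →
  (ps : List (V G × V G)) → All (λ p → Adj G (proj₁ p) (proj₂ p)) ps → List (Fin k)
edgeColours φ []       []       = []
edgeColours φ (p ∷ ps) (e ∷ es) = EdgeColouring.col φ (proj₁ p) (proj₂ p) e ∷ edgeColours φ ps es

pathColours : {G : Graph} {k : ℕ} {u v : V G} → EdgeColouring G k → Path G u v → List (Fin k)
pathColours φ P = edgeColours φ (pairs (Path.verts P)) (Path.edges P)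

LooseColours : {k : ℕ} → List (Fin k) → Set
LooseColours []              = ⊥
LooseColours (a ∷ [])        = ⊤
LooseColours (a ∷ b ∷ [])    = a ≢ b
LooseColours cs@(_ ∷ _ ∷ _ ∷ _) =
  Σ _ λ c₁ → Σ _ λ c₂ → Σ _ λ c₃ →
    c₁ ∈ cs × c₂ ∈ cs × c₃ ∈ cs × c₁ ≢ c₂ × c₁ ≢ c₃ × c₂ ≢ c₃

LoosePath : {G : Graph} {k : ℕ} → EdgeColouring G k → V G → V G → Set
LoosePath {G} φ u v = Σ (Path G u v) λ P → LooseColours (pathColours φ P)

LooselyConnecting : {G : Graph} {k : ℕ} → EdgeColouring G k → Set
LooselyConnecting {G} φ = ∀ (u v : V G) → u ≢ v → LoosePath φ u v

LooseConnectable : Graph → ℕ → Set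
LooseConnectable G k = Σ (EdgeColouring G k) LooselyConnecting

IsLec : Graph → ℕ → Set
IsLec G m = LooseConnectable G m × (∀ k → LooseConnectable G k → m ≤ k)

IsBridge : (G : Graph) → V G → V G → Set
IsBridge G x y = Adj G x y ×
  ¬ Σ (Path G x y) (λ P → ¬ ((x , y) ∈ pairs (Path.verts P))
                         × ¬ ((y , x) ∈ pairs (Path.verts P)))

-- v has at least d neighbours in the cut-edge graph C(G)
BridgeDegAtLeast : (G : Graph) → V G → ℕ → Set
BridgeDegAtLeast G v d =
  Σ (Fin d → V G) λ f → Injective _≡_ _≡_ f × (∀ i → IsBridge G v (f i))

-- Δ(C(G)) = d  (d = 0 if G has no cut-edges)
IsMaxCutDeg : Graph → ℕ → Set
IsMaxCutDeg G d =
  Σ (V G) (λ v → BridgeDegAtLeast G v d) × (∀ v → ¬ BridgeDegAtLeast G v (suc d))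

{-# OPTIONS --safe #-}
module Submission where

-- Suppose G is not complete.
-- Lower bounds: the only path between two leaves at x is the one through x, so the edges at
-- x to its leaves receive different colours; and with a single colour only adjacent vertices
-- are joined by a loose path.
-- Upper bounds: colour the edges at a suitable vertex x by a function g of the other end and
-- all remaining edges by r = 2.  If x is universal, g is injective on the leaves at x and
-- elsewhere indicates a maximal independent set of G − x.  If no vertex is universal, no
-- vertex is a cut vertex, and for any edge xa one takes g = 0 at a and g = 1 elsewhere: two
-- non-adjacent vertices other than x are linked by disjoint paths to the ends of xa, so some
-- path between them runs through xa and sees the colours 0 and 1, and also 2 unless it has
-- only two edges.
-- Hence lec(G) is the number ℓ of leaves at a universal vertex if ℓ ≥ 3, and at most 3
-- otherwise; the edges to these leaves are bridges.  Stars attain all the bounds.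

open import Defs
open import Data.Nat using (ℕ; zero; suc; _≤_; _⊔_; z≤n; s≤s; _*_; _≤?_)
open import Data.Nat.Properties using (≤-refl; ≤-trans; ≤∧≢⇒<; 1+n≰n; m≤n⇒m≤1+n; ≰⇒>; ≮⇒≥; m≤m⊔n; m≤n⊔m; <⇒≤)
open import Data.Fin using (Fin; zero; suc; inject≤; combine; remQuot; punchOut; _≟_)
open import Data.Fin.Properties
  using (any?; all?; ¬∀⟶∃¬; injective⇒≤; inject≤-injective; punchOut-injective; remQuot-combine)
open import Data.Fin.Subset using (Subset)
open import Data.Fin.Subset.Properties using (anySubset?)
open import Data.Bool using (Bool; true; false; _∨_; T)
open import Data.Bool.Properties using (T?; T-irrelevant; ∨-comm; ∨-idem)
import Data.Bool.Properties as Bool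
open import Data.Vec using (tabulate; lookup)
open import Data.Vec.Properties using (lookup∘tabulate)
open import Data.List using (List; []; _∷_; _++_; length; filter; allFin)
import Data.List as List
open import Data.List.Membership.Propositional using (_∈_; _∉_)
open import Data.List.Membership.Propositional.Properties
  using (∈-++⁺ˡ; ∈-++⁺ʳ; ∈-++⁻; ∈-filter⁺; ∈-filter⁻; ∈-allFin; ∈-lookup)
open import Data.List.Relation.Binary.Disjoint.Propositional using (Disjoint)
open import Data.List.Relation.Binary.Subset.Propositional using (_⊆_)
open import Data.List.Relation.Unary.All as All using (All; []; _∷_)
open import Data.List.Relation.Unary.All.Properties using (¬Any⇒All¬)
open import Data.List.Relation.Unary.AllPairs using ([]; _∷_)
open import Data.List.Relation.Unary.Any as Any using (here; there)
open import Data.List.Relation.Unary.Any.Properties using (lookup-index)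
open import Data.List.Relation.Unary.Unique.Propositional using (Unique)
open import Data.List.Relation.Unary.Unique.Propositional.Properties using (++⁺; allFin⁺; filter⁺)
open import Data.Product using (Σ; ∃; _×_; _,_; proj₁; proj₂)
open import Data.Sum using (_⊎_; inj₁; inj₂; [_,_]′)
import Data.Sum as Sum
open import Data.Empty using (⊥; ⊥-elim)
open import Data.Unit using (tt)
open import Function using (_∘_; case_of_)
open import Function.Definitions using (Injective)
open import Relation.Nullary using (¬_; Dec; yes; no; contradiction)
open import Relation.Nullary.Decidable using (_×-dec_; _⊎-dec_; _→-dec_; ¬?; map′; decidable-stable)
open import Relation.Binary.PropositionalEquality as ≡
  using (_≡_; _≢_; refl; cong; cong₂; subst; trans; ≢-sym)

-- Loose colour lists and finite preliminaries.

module _ {k : ℕ} where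

  -- Covers lists of every length, so that a caller need not know how long its path is: in a list of
  -- two entries, `a` and `b` already occupy both places.
  loose-three : {cs : List (Fin k)} {a b c : Fin k} → a ∈ cs → b ∈ cs → c ∈ cs →
    a ≢ b → a ≢ c → b ≢ c → LooseColours cs
  loose-three {_ ∷ []}        (here refl)         (here refl)         _  a≢b _ _ = tt
  loose-three {_ ∷ _ ∷ []}    (here refl)         (here refl)         _  a≢b _ _ = contradiction refl a≢b
  loose-three {_ ∷ _ ∷ []}    (here refl)         (there (here refl)) _  a≢b _ _ = a≢b
  loose-three {_ ∷ _ ∷ []}    (there (here refl)) (here refl)         _  a≢b _ _ = ≢-sym a≢b
  loose-three {_ ∷ _ ∷ []}    (there (here refl)) (there (here refl)) _  a≢b _ _ = contradiction refl a≢b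
  loose-three {_ ∷ _ ∷ _ ∷ _} a∈ b∈ c∈ a≢b a≢c b≢c = _ , _ , _ , a∈ , b∈ , c∈ , a≢b , a≢c , b≢c

fin2-pigeonhole : {a b c : Fin 2} → a ≢ b → a ≢ c → b ≢ c → ⊥
fin2-pigeonhole {zero}     {zero}     {_}        a≢b _   _   = a≢b refl
fin2-pigeonhole {zero}     {suc zero} {zero}     _   a≢c _   = a≢c refl
fin2-pigeonhole {zero}     {suc zero} {suc zero} _   _   b≢c = b≢c refl
fin2-pigeonhole {suc zero} {suc zero} {_}        a≢b _   _   = a≢b refl
fin2-pigeonhole {suc zero} {zero}     {zero}     _   _   b≢c = b≢c refl
fin2-pigeonhole {suc zero} {zero}     {suc zero} _   a≢c _   = a≢c refl

lookup-injective : {A : Set} {xs : List A} → Unique xs → Injective _≡_ _≡_ (List.lookup xs)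
lookup-injective (_ ∷ _)    {zero}  {zero}  _  = refl
lookup-injective (x∉xs ∷ _) {zero}  {suc j} eq = contradiction eq (All.lookup x∉xs (∈-lookup j))
lookup-injective (x∉xs ∷ _) {suc i} {zero}  eq = contradiction (≡.sym eq) (All.lookup x∉xs (∈-lookup i))
lookup-injective (_ ∷ u)    {suc i} {suc j} eq = cong suc (lookup-injective u eq)

-- Adjacency, walks and loop erasure.

module _ (G : Graph) where

  Adj-sym : ∀ {u v} → Adj G u v → Adj G v u
  Adj-sym {u} {v} = subst T (sym G u v)

  ¬Adj-refl : ∀ {v} → ¬ Adj G v v
  ¬Adj-refl {v} = subst T (irrefl G v)

  Adj⇒≢ : ∀ {u v} → Adj G u v → u ≢ v
  Adj⇒≢ e refl = ¬Adj-refl e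

  Adj? : ∀ u v → Dec (Adj G u v)
  Adj? u v = T? (adj G u v)

  _∈?_ : (v : V G) (xs : List (V G)) → Dec (v ∈ xs)
  v ∈? xs = Any.any? (v ≟_) xs

  -- Walks may repeat vertices and so concatenate freely. The operations below mostly record
  -- inclusions of vertex sets, because avoiding a vertex and being disjoint pass to subsets.
  data Walk : V G → V G → Set where
    stop : ∀ {u} → Walk u u
    step : ∀ {u w v} → Adj G u w → Walk w v → Walk u v

  vertices : ∀ {u v} → Walk u v → List (V G)
  vertices (stop {u})     = u ∷ []
  vertices (step {u} _ W) = u ∷ vertices W

  end-∈ : ∀ {u v} (W : Walk u v) → v ∈ vertices W
  end-∈ stop       = here refl
  end-∈ (step _ W) = there (end-∈ W)

  _++ʷ_ : ∀ {u w v} → Walk u w → Walk w v → Walk u v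
  stop     ++ʷ W′ = W′
  step e W ++ʷ W′ = step e (W ++ʷ W′)

  ∈-++ʷ⁻ : ∀ {u w v t} (W : Walk u w) (W′ : Walk w v) → t ∈ vertices (W ++ʷ W′) →
    t ∈ vertices W ⊎ t ∈ vertices W′
  ∈-++ʷ⁻ stop       W′ t∈         = inj₂ t∈
  ∈-++ʷ⁻ (step e W) W′ (here eq)  = inj₁ (here eq)
  ∈-++ʷ⁻ (step e W) W′ (there t∈) = Sum.map₁ there (∈-++ʷ⁻ W W′ t∈)

  reverseʷ : ∀ {u v} (W : Walk u v) → Σ (Walk v u) λ W′ → vertices W′ ⊆ vertices W
  reverseʷ stop = stop , λ t∈ → t∈
  reverseʷ (step {u} {w} e W) with reverseʷ W
  ... | W′ , W′⊆W = W′ ++ʷ step (Adj-sym e) stop , λ t∈ → case ∈-++ʷ⁻ W′ _ t∈ of λ where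
    (inj₁ t∈W′)               → there (W′⊆W t∈W′)
    (inj₂ (here refl))         → there (W′⊆W (end-∈ W′))
    (inj₂ (there (here refl))) → here refl

  dropUntil : ∀ {u v t} (W : Walk u v) → Unique (vertices W) → t ∈ vertices W →
    Σ (Walk t v) λ W′ → Unique (vertices W′) × vertices W′ ⊆ vertices W
  dropUntil stop       !W       (here refl) = stop , !W , λ t∈ → t∈
  dropUntil (step e W) !W       (here refl) = step e W , !W , λ t∈ → t∈
  dropUntil (step e W) (_ ∷ !W) (there t∈)  with dropUntil W !W t∈
  ... | W′ , !W′ , W′⊆W = W′ , !W′ , there ∘ W′⊆W

  -- The tail is made simple first; if `u` occurs in it already, the part before that occurrence is
  -- dropped instead of prepending `u` again.
  eraseLoops : ∀ {u v} (W : Walk u v) →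
    Σ (Walk u v) λ W′ → Unique (vertices W′) × vertices W′ ⊆ vertices W
  eraseLoops stop = stop , [] ∷ [] , λ t∈ → t∈
  eraseLoops (step {u} e W) with eraseLoops W
  ... | W′ , !W′ , W′⊆W with u ∈? vertices W′
  ...   | no u∉ = step e W′ , ¬Any⇒All¬ _ u∉ ∷ !W′ , λ where
            (here eq)  → here eq
            (there t∈) → there (W′⊆W t∈)
  ...   | yes u∈ with dropUntil W′ !W′ u∈
  ...     | W″ , !W″ , W″⊆W′ = W″ , !W″ , there ∘ W′⊆W ∘ W″⊆W′

  -- The walk is cut just before its first visit to `x`.
  beforeHit : ∀ {u x} (W : Walk u x) → u ≢ x → Σ (V G) λ p → Σ (Walk u p) λ W′ →
    Adj G p x × x ∉ vertices W′ × vertices W′ ⊆ vertices W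
  beforeHit stop u≢x = contradiction refl u≢x
  beforeHit {u} {x} (step {w = w} e W) u≢x with w ≟ x
  ... | yes refl = u , stop , e , (λ { (here x≡u) → u≢x (≡.sym x≡u) }) , λ { (here eq) → here eq }
  ... | no w≢x with beforeHit W w≢x
  ...   | p , W′ , e′ , x∉W′ , W′⊆W = p , step e W′ , e′
          , (λ { (here x≡u) → u≢x (≡.sym x≡u) ; (there x∈) → x∉W′ x∈ })
          , λ { (here eq) → here eq ; (there t∈) → there (W′⊆W t∈) }

  unsnoc : ∀ {w v} (W : Walk w v) → Σ (List (V G)) λ mid → vertices W ≡ mid ++ v ∷ []
  unsnoc stop = [] , refl
  unsnoc (step {w} _ W) with unsnoc W
  ... | mid , eq = w ∷ mid , cong (w ∷_) eq

  edges-walk : ∀ {u v} (W : Walk u v) → All (λ p → Adj G (proj₁ p) (proj₂ p)) (pairs (vertices W))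
  edges-walk stop                = []
  edges-walk (step e stop)       = e ∷ []
  edges-walk (step e (step f W)) = e ∷ edges-walk (step f W)

  -- Colours along walks and the loose paths they yield.

  module _ {k : ℕ} (c : V G → V G → Fin k) (c-sym : ∀ u v → c u v ≡ c v u) where

    colouring : EdgeColouring G k
    colouring = record { col = λ u v _ → c u v ; colSym = λ u v _ _ → c-sym u v }

    colours : ∀ {u v} → Walk u v → List (Fin k)
    colours stop               = []
    colours (step {u} {w} _ W) = c u w ∷ colours W

    colours-++ʷ : ∀ {u w v} (W : Walk u w) (W′ : Walk w v) →
      colours (W ++ʷ W′) ≡ colours W ++ colours W′
    colours-++ʷ stop       W′ = refl
    colours-++ʷ (step e W) W′ = cong (_ ∷_) (colours-++ʷ W W′)

    edgeColours-walk : ∀ {u v} (W : Walk u v) →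
      edgeColours colouring (pairs (vertices W)) (edges-walk W) ≡ colours W
    edgeColours-walk stop                = refl
    edgeColours-walk (step e stop)       = refl
    edgeColours-walk (step e (step f W)) = cong (_ ∷_) (edgeColours-walk (step f W))

    walk⇒loosePath : ∀ {u v} (W : Walk u v) → u ≢ v → Unique (vertices W) →
      LooseColours (colours W) → LoosePath colouring u v
    walk⇒loosePath stop u≢v _ _ = contradiction refl u≢v
    walk⇒loosePath {u} {v} (step e W) _ !W loose with unsnoc W
    ... | mid , eq = fromList (cong (u ∷_) eq) !W (edges-walk (step e W))
                       (subst LooseColours (≡.sym (edgeColours-walk (step e W))) loose)
      where
      -- A `Path` wants its vertex list in the form `u ∷ mid ++ v ∷ []`, which `unsnoc` gives only
      -- propositionally; with the list abstracted to `ws` the equation can be matched.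
      fromList : ∀ {ws} → ws ≡ u ∷ mid ++ v ∷ [] → Unique ws → (es : All _ (pairs ws)) →
        LooseColours (edgeColours colouring (pairs ws) es) → LoosePath colouring u v
      fromList refl !ws es loose = record { mid = mid ; unique = !ws ; edges = es } , loose

    edge⇒loosePath : ∀ {u v} → Adj G u v → LoosePath colouring u v
    edge⇒loosePath e = walk⇒loosePath (step e stop) (Adj⇒≢ e) ((Adj⇒≢ e ∷ []) ∷ [] ∷ []) tt

    cherry⇒loosePath : ∀ {u w v} → Adj G u w → Adj G w v → u ≢ v → c u w ≢ c w v → LoosePath colouring u v
    cherry⇒loosePath e f u≢v =
      walk⇒loosePath (step e (step f stop)) u≢v ((Adj⇒≢ e ∷ u≢v ∷ []) ∷ (Adj⇒≢ f ∷ []) ∷ [] ∷ [])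

  -- Universal vertices and star colourings.

  Universal : V G → Set
  Universal x = ∀ v → v ≢ x → Adj G x v

  universal? : ∀ x → Dec (Universal x)
  universal? x = all? λ v → ¬? (v ≟ x) →-dec Adj? x v

  -- Edges at x are coloured by g, all others by r; so a path through x is loose once
  -- it enters and leaves x in different colours other than r.
  module StarColouring (x : V G) {k : ℕ} (g : V G → Fin k) (r : Fin k) where

    starColour : V G → V G → Fin k
    starColour u v with u ≟ x | v ≟ x
    ... | yes _ | _     = g v
    ... | no _  | yes _ = g u
    ... | no _  | no _  = r

    starColour-sym : ∀ u v → starColour u v ≡ starColour v u
    starColour-sym u v with u ≟ x | v ≟ x
    ... | yes refl | yes refl = refl
    ... | yes _    | no _     = refl
    ... | no _     | yes _    = refl
    ... | no _     | no _     = refl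

    starColour-from : ∀ v → starColour x v ≡ g v
    starColour-from v with x ≟ x
    ... | yes _  = refl
    ... | no x≢x = contradiction refl x≢x

    starColour-to : ∀ u → starColour u x ≡ g u
    starColour-to u = trans (starColour-sym u x) (starColour-from u)

    starColour-off : ∀ {u v} → u ≢ x → v ≢ x → starColour u v ≡ r
    starColour-off {u} {v} u≢x v≢x with u ≟ x | v ≟ x
    ... | yes u≡x | _       = contradiction u≡x u≢x
    ... | no _    | yes v≡x = contradiction v≡x v≢x
    ... | no _    | no _    = refl

    star : EdgeColouring G k
    star = colouring starColour starColour-sym

    private
      cols : ∀ {u v} → Walk u v → List (Fin k)
      cols = colours starColour starColour-sym

    stop⊎off : ∀ {u v} (W : Walk u v) → x ∉ vertices W → (cols W ≡ []) ⊎ (r ∈ cols W)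
    stop⊎off stop _ = inj₁ refl
    stop⊎off (step e W) x∉ = inj₂ (here (≡.sym (starColour-off (x∉ ∘ here ∘ ≡.sym) (x∉ ∘ there ∘ head W))))
      where
      head : ∀ {u v} (W : Walk u v) → u ≡ x → x ∈ vertices W
      head stop       eq = here (≡.sym eq)
      head (step _ _) eq = here (≡.sym eq)

    -- If both walks are single vertices, the path has just the two edges at `x`, of colours `g p`
    -- and `g q`. Otherwise some edge misses `x` and brings `r` as a third colour.
    through⇒loosePath : ∀ {u p q v} (W₁ : Walk u p) (W₂ : Walk q v) →
      x ∉ vertices W₁ → x ∉ vertices W₂ → Disjoint (vertices W₁) (vertices W₂) →
      Adj G p x → Adj G x q → g p ≢ g q → g p ≢ r → g q ≢ r → LoosePath star u v
    through⇒loosePath {u} {p} {q} {v} W₁⁰ W₂⁰ x∉W₁⁰ x∉W₂⁰ disjoint⁰ p~x x~q gp≢gq gp≢r gq≢r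
      with eraseLoops W₁⁰ | eraseLoops W₂⁰
    ... | W₁ , !W₁ , W₁⊆ | W₂ , !W₂ , W₂⊆ =
      walk⇒loosePath starColour starColour-sym W u≢v
        (subst Unique (≡.sym (vertices-W W₁)) (++⁺ !W₁ (¬Any⇒All¬ _ (x∉W₂⁰ ∘ W₂⊆) ∷ !W₂) disjoint))
        (subst LooseColours (≡.sym colours-W) loose)
      where
      W : Walk u v
      W = W₁ ++ʷ step p~x (step x~q W₂)

      disjoint : Disjoint (vertices W₁) (x ∷ vertices W₂)
      disjoint (t∈₁ , here refl) = x∉W₁⁰ (W₁⊆ t∈₁)
      disjoint (t∈₁ , there t∈₂) = disjoint⁰ (W₁⊆ t∈₁ , W₂⊆ t∈₂)

      start-∈ : ∀ {u v} (W : Walk u v) → u ∈ vertices W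
      start-∈ stop       = here refl
      start-∈ (step _ _) = here refl

      u≢v : u ≢ v
      u≢v refl = disjoint⁰ (start-∈ W₁⁰ , end-∈ W₂⁰)

      vertices-W : ∀ {u} (W₁ : Walk u p) →
        vertices (W₁ ++ʷ step p~x (step x~q W₂)) ≡ vertices W₁ ++ x ∷ vertices W₂
      vertices-W stop        = refl
      vertices-W (step _ W₁) = cong (_ ∷_) (vertices-W W₁)

      cs : List (Fin k)
      cs = cols W₁ ++ g p ∷ g q ∷ cols W₂

      colours-W : cols W ≡ cs
      colours-W = trans (colours-++ʷ starColour starColour-sym W₁ _)
        (cong (cols W₁ ++_) (cong₂ (λ a b → a ∷ b ∷ cols W₂) (starColour-to p) (starColour-from q)))

      three : r ∈ cs → LooseColours cs
      three r∈ = loose-three (∈-++⁺ʳ (cols W₁) (here refl)) (∈-++⁺ʳ (cols W₁) (there (here refl))) r∈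
        gp≢gq gp≢r gq≢r

      loose : LooseColours cs
      loose with stop⊎off W₁ (x∉W₁⁰ ∘ W₁⊆) | stop⊎off W₂ (x∉W₂⁰ ∘ W₂⊆)
      ... | inj₂ r∈  | _        = three (∈-++⁺ˡ r∈)
      ... | inj₁ _   | inj₂ r∈  = three (∈-++⁺ʳ (cols W₁) (there (there r∈)))
      ... | inj₁ eq₁ | inj₁ eq₂ = subst LooseColours
              (≡.sym (cong₂ (λ as bs → as ++ g p ∷ g q ∷ bs) eq₁ eq₂)) gp≢gq

  -- Leaves, independent sets and graphs with a universal vertex.

  Leaf : V G → V G → Set
  Leaf x y = Adj G x y × (∀ z → Adj G y z → z ≡ x)

  leaf? : ∀ x y → Dec (Leaf x y)
  leaf? x y = Adj? x y ×-dec all? λ z → Adj? y z →-dec (z ≟ x)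

  leaves : V G → List (V G)
  leaves x = filter (leaf? x) (allFin (n G))

  leaves-lookup : ∀ x i → Leaf x (List.lookup (leaves x) i)
  leaves-lookup x i = proj₂ (∈-filter⁻ (leaf? x) {xs = allFin (n G)} (∈-lookup i))

  leaves-distinct : ∀ x → Injective _≡_ _≡_ (List.lookup (leaves x))
  leaves-distinct x = lookup-injective (filter⁺ (leaf? x) (allFin⁺ (n G)))

  nonleaf-neighbour : ∀ {x u} → Adj G x u → ¬ Leaf x u → Σ (V G) λ w → Adj G u w × w ≢ x
  nonleaf-neighbour {x} {u} x~u ¬leaf
    with ¬∀⟶∃¬ _ _ (λ z → Adj? u z →-dec (z ≟ x)) (λ all → ¬leaf (x~u , all))
  ... | w , ¬imp = w , decidable-stable (Adj? u w) (λ ≁ → ¬imp (λ ~ → contradiction ~ ≁)) , λ w≡x → ¬imp λ _ → w≡x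

  -- Greedy choice: a vertex joins unless it already has a neighbour in the set, and that neighbour
  -- then dominates it.
  maximalIndependent : (xs : List (V G)) → Σ (List (V G)) λ M → M ⊆ xs
    × (∀ {u v} → u ∈ M → v ∈ M → ¬ Adj G u v)
    × (∀ {u} → u ∈ xs → u ∉ M → Σ (V G) λ w → w ∈ M × Adj G u w)
  maximalIndependent [] = [] , (λ ()) , (λ ()) , λ ()
  maximalIndependent (x ∷ xs) with maximalIndependent xs
  ... | M , M⊆xs , indep , dom with Any.any? (Adj? x) M
  ...   | yes x~M = M , there ∘ M⊆xs , indep , λ where
            (here refl) _  → Any.lookup x~M , ∈-lookup (Any.index x~M) , lookup-index x~M
            (there u∈) u∉M → dom u∈ u∉M
  ...   | no x≁M = x ∷ M
          , (λ { (here eq) → here eq ; (there u∈) → there (M⊆xs u∈) })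
          , (λ { (here refl) (here refl) → ¬Adj-refl
               ; (here refl) (there v∈)  → All.lookup (¬Any⇒All¬ M x≁M) v∈
               ; (there u∈)  (here refl) → All.lookup (¬Any⇒All¬ M x≁M) u∈ ∘ Adj-sym
               ; (there u∈)  (there v∈)  → indep u∈ v∈ })
          , λ where
              (here refl) u∉ → contradiction (here refl) u∉
              (there u∈) u∉  → case dom u∈ (u∉ ∘ there) of λ (w , w∈ , u~w) → w , there w∈ , u~w

  -- The leaves at x get pairwise different colours at x; the other neighbours of x get 0 or 1
  -- according to a maximal independent set of G − x, so that each of them has a neighbour of
  -- the opposite class to detour through.
  universal⇒connectable : ∀ {x} → Universal x → ∀ {k} → 3 ≤ k → length (leaves x) ≤ k → LooseConnectable G k
  universal⇒connectable {x} univ {suc (suc (suc k))} (s≤s (s≤s (s≤s _))) ℓ≤k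
    with maximalIndependent (filter (λ v → ¬? (v ≟ x)) (allFin (n G)))
  ... | M , M⊆ , indep , dom = star , connects
    where
    leaf-∈ : ∀ {u} → Leaf x u → u ∈ leaves x
    leaf-∈ = ∈-filter⁺ (leaf? x) (∈-allFin _)

    ≢x-∈ : ∀ {u} → u ≢ x → u ∈ filter (λ v → ¬? (v ≟ x)) (allFin (n G))
    ≢x-∈ = ∈-filter⁺ (λ v → ¬? (v ≟ x)) (∈-allFin _)

    M-≢x : ∀ {u} → u ∈ M → u ≢ x
    M-≢x u∈M = proj₂ (∈-filter⁻ (λ v → ¬? (v ≟ x)) {xs = allFin (n G)} (M⊆ u∈M))

    g : V G → Fin (suc (suc (suc k)))
    g u with leaf? x u | u ∈? M
    -- The position in `leaves x` serves as colour. It may equal `r`: a leaf is used in a longer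
    -- path only if it shares its colour, 0 or 1, with a non-leaf.
    ... | yes l | _     = inject≤ (Any.index (leaf-∈ l)) ℓ≤k
    ... | no _  | yes _ = zero
    ... | no _  | no _  = suc zero

    g-member : ∀ {u} → ¬ Leaf x u → u ∈ M → g u ≡ zero
    g-member {u} ¬l u∈ with leaf? x u | u ∈? M
    ... | yes l | _     = contradiction l ¬l
    ... | no _  | yes _ = refl
    ... | no _  | no u∉ = contradiction u∈ u∉

    g-nonmember : ∀ {u} → ¬ Leaf x u → u ∉ M → g u ≡ suc zero
    g-nonmember {u} ¬l u∉ with leaf? x u | u ∈? M
    ... | yes l | _      = contradiction l ¬l
    ... | no _  | yes u∈ = contradiction u∈ u∉
    ... | no _  | no _   = refl

    g-leaf-injective : ∀ {u v} → Leaf x u → Leaf x v → g u ≡ g v → u ≡ v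
    g-leaf-injective {u} {v} lu lv eq with leaf? x u | leaf? x v
    ... | no ¬lu | _      = contradiction lu ¬lu
    ... | yes _  | no ¬lv = contradiction lv ¬lv
    ... | yes lu | yes lv = trans (lookup-index (leaf-∈ lu)) (trans
            (cong (List.lookup (leaves x)) (inject≤-injective ℓ≤k ℓ≤k _ _ eq))
            (≡.sym (lookup-index (leaf-∈ lv))))

    r : Fin (suc (suc (suc k)))
    r = suc (suc zero)

    open StarColouring x g r

    zero-one : ∀ {u w} → g u ≡ zero → g w ≡ suc zero → g u ≢ g w × g u ≢ r × g w ≢ r
    zero-one gu gw rewrite gu | gw = (λ ()) , (λ ()) , λ ()

    -- A neighbour of `u` other than `x` is no leaf, as it is adjacent to `u`. If `u` lies in `M`,
    -- independence puts any such neighbour outside; if not, domination provides one inside.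
    detour : ∀ {u} → u ≢ x → ¬ Leaf x u → Σ (V G) λ w →
      Adj G u w × w ≢ x × g u ≢ g w × g u ≢ r × g w ≢ r
    detour {u} u≢x ¬leaf = by-class (u ∈? M)
      where
      ¬leaf-neighbour : ∀ {w} → Adj G u w → ¬ Leaf x w
      ¬leaf-neighbour u~w (_ , only) = u≢x (only u (Adj-sym u~w))

      by-class : Dec (u ∈ M) → Σ (V G) λ w →
        Adj G u w × w ≢ x × g u ≢ g w × g u ≢ r × g w ≢ r
      by-class (yes u∈) with nonleaf-neighbour (univ u u≢x) ¬leaf
      ... | w , u~w , w≢x = w , u~w , w≢x ,
              zero-one (g-member ¬leaf u∈) (g-nonmember (¬leaf-neighbour u~w) λ w∈ → indep u∈ w∈ u~w)
      by-class (no u∉) with dom (≢x-∈ u≢x) u∉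
      ... | w , w∈ , u~w
          with zero-one (g-member (¬leaf-neighbour u~w) w∈) (g-nonmember ¬leaf u∉)
      ...   | gw≢gu , gw≢r , gu≢r = w , u~w , M-≢x w∈ , ≢-sym gw≢gu , gu≢r , gw≢r

    -- Here the path through `x` alone is monochromatic. Two leaves never share a colour, so one end
    -- is a non-leaf; say `u`, with detour `w`. Then `u`, `w`, `x`, `v` sees `r`, `g w` and `g v`.
    equal-colours : ∀ {u v} → u ≢ v → u ≢ x → v ≢ x → g u ≡ g v →
      Dec (Leaf x u) → Dec (Leaf x v) → LoosePath star u v
    equal-colours u≢v u≢x v≢x gu≡gv (yes lu) (yes lv) =
      contradiction (g-leaf-injective lu lv gu≡gv) u≢v
    equal-colours {u} {v} u≢v u≢x v≢x gu≡gv (no ¬lu) _ with detour u≢x ¬lu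
    ... | w , u~w , w≢x , gu≢gw , gu≢r , gw≢r =
      through⇒loosePath (step u~w stop) stop
        (λ { (here x≡u) → u≢x (≡.sym x≡u) ; (there (here x≡w)) → w≢x (≡.sym x≡w) })
        (λ { (here x≡v) → v≢x (≡.sym x≡v) })
        (λ { (here refl , here refl) → u≢v refl ; (there (here refl) , here refl) → gu≢gw gu≡gv })
        (Adj-sym (univ w w≢x)) (univ v v≢x)
        (λ gw≡gv → gu≢gw (trans gu≡gv (≡.sym gw≡gv))) gw≢r (subst (_≢ r) gu≡gv gu≢r)
    equal-colours {u} {v} u≢v u≢x v≢x gu≡gv (yes _) (no ¬lv) with detour v≢x ¬lv
    ... | w , v~w , w≢x , gv≢gw , gv≢r , gw≢r =
      through⇒loosePath stop (step (Adj-sym v~w) stop)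
        (λ { (here x≡u) → u≢x (≡.sym x≡u) })
        (λ { (here x≡w) → w≢x (≡.sym x≡w) ; (there (here x≡v)) → v≢x (≡.sym x≡v) })
        (λ { (here refl , here refl) → gv≢gw (≡.sym gu≡gv) ; (here refl , there (here refl)) → u≢v refl })
        (Adj-sym (univ u u≢x)) (univ w w≢x)
        (λ gu≡gw → gv≢gw (trans (≡.sym gu≡gv) gu≡gw)) (subst (_≢ r) (≡.sym gu≡gv) gv≢r) gw≢r

    connects : LooselyConnecting star
    connects u v u≢v = by-ends (u ≟ x) (v ≟ x) (g u ≟ g v)
      where
      by-ends : Dec (u ≡ x) → Dec (v ≡ x) → Dec (g u ≡ g v) → LoosePath star u v
      by-ends (yes refl) _          _ = edge⇒loosePath starColour starColour-sym (univ v (≢-sym u≢v))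
      by-ends (no _)     (yes refl) _ = edge⇒loosePath starColour starColour-sym (Adj-sym (univ u u≢v))
      by-ends (no u≢x) (no v≢x) (yes gu≡gv) =
        equal-colours u≢v u≢x v≢x gu≡gv (leaf? x u) (leaf? x v)
      by-ends (no u≢x) (no v≢x) (no gu≢gv) = cherry⇒loosePath starColour starColour-sym
        (Adj-sym (univ u u≢x)) (univ v v≢x) u≢v
        (λ eq → gu≢gv (trans (≡.sym (starColour-to u)) (trans eq (starColour-from v))))

  -- Diameter two: disjoint links to the ends of an edge.

  module _ (diam : DiamAtMost2 G) where

    -- The membership property drives the avoidance arguments below: a vertex not adjacent to both
    -- `y` and `z` can lie on the walk only as one of its ends.
    hop : ∀ y z → Σ (Walk y z) λ W →
      ∀ {t} → t ∈ vertices W → t ≡ y ⊎ t ≡ z ⊎ (Adj G y t × Adj G t z)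
    hop y z with diam y z
    ... | inj₁ refl = stop , λ { (here refl) → inj₁ refl }
    ... | inj₂ (inj₁ y~z) = step y~z stop , λ where
            (here refl)         → inj₁ refl
            (there (here refl)) → inj₂ (inj₁ refl)
    ... | inj₂ (inj₂ (m , y~m , m~z)) = step y~m (step m~z stop) , λ where
            (here refl)                 → inj₁ refl
            (there (here refl))         → inj₂ (inj₂ (y~m , m~z))
            (there (there (here refl))) → inj₂ (inj₁ refl)

    commonNeighbour : ∀ {u v} → u ≢ v → ¬ Adj G u v → Σ (V G) λ w → Adj G u w × Adj G w v
    commonNeighbour {u} {v} u≢v u≁v with diam u v
    ... | inj₁ u≡v        = contradiction u≡v u≢v
    ... | inj₂ (inj₁ u~v) = contradiction u~v u≁v
    ... | inj₂ (inj₂ w)   = w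

    -- Joined by the edge between `x` and `a`, the two walks yield a path from `u` to `v` through
    -- that edge.
    record Link (x a u v : V G) : Set where
      constructor link
      field
        {walk₁}  : Walk u x
        {walk₂}  : Walk v a
        disjoint : Disjoint (vertices walk₁) (vertices walk₂)

    swap : ∀ {x a u v} → Link x a u v → Link a x v u
    swap (link d) = link (λ (t∈₂ , t∈₁) → d (t∈₁ , t∈₂))

    Linked : (x a u v : V G) → Set
    Linked x a u v = Link x a u v ⊎ Link a x u v

    Linked-swap : ∀ {x a u v} → Linked x a u v → Linked x a v u
    Linked-swap = [ inj₂ ∘ swap , inj₁ ∘ swap ]′

    Linked-swapEdge : ∀ {x a u v} → Linked x a u v → Linked a x u v
    Linked-swapEdge = Sum.swap

    module _ (¬universal : ∀ x → ¬ Universal x) where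

      nonneighbour : ∀ c → Σ (V G) λ w → w ≢ c × ¬ Adj G c w
      nonneighbour c with ¬∀⟶∃¬ _ _ (λ v → ¬? (v ≟ c) →-dec Adj? c v) (¬universal c)
      ... | w , ¬imp = w , (λ w≡c → ¬imp λ w≢c → contradiction w≡c w≢c) , λ c~w → ¬imp λ _ → c~w

      -- Two hops meeting in a non-neighbour of a cannot pass through a.
      linked-at : ∀ {x a v} → Adj G x a → v ≢ x → v ≢ a → Linked x a a v
      linked-at {x} {a} {v} x~a v≢x v≢a with nonneighbour a
      ... | w , w≢a , a≁w with hop v w | hop w x
      ...   | W , in-W | W′ , in-W′ = inj₂ (link {walk₁ = stop} {walk₂ = W ++ʷ W′} λ where
              (here refl , a∈) → [ avoids-W ∘ in-W , avoids-W′ ∘ in-W′ ]′ (∈-++ʷ⁻ W W′ a∈))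
        where
        avoids-W : ¬ (a ≡ v ⊎ a ≡ w ⊎ (Adj G v a × Adj G a w))
        avoids-W (inj₁ a≡v)             = v≢a (≡.sym a≡v)
        avoids-W (inj₂ (inj₁ a≡w))      = w≢a (≡.sym a≡w)
        avoids-W (inj₂ (inj₂ (_ , a~w))) = a≁w a~w
        avoids-W′ : ¬ (a ≡ w ⊎ a ≡ x ⊎ (Adj G w a × Adj G a x))
        avoids-W′ (inj₁ a≡w)              = w≢a (≡.sym a≡w)
        avoids-W′ (inj₂ (inj₁ a≡x))       = Adj⇒≢ x~a (≡.sym a≡x)
        avoids-W′ (inj₂ (inj₂ (w~a , _))) = a≁w (Adj-sym w~a)

      -- If `v` is not adjacent to `x`, then `u` steps to `x` and a hop from `v` to `a` misses `u`
      -- and `x`, both non-neighbours of `v`. If `v` is adjacent to `x` and `u` to `a`, these two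
      -- edges do.
      linked-adjacent : ∀ {x a u v} → Adj G x a → u ≢ v → ¬ Adj G u v →
        u ≢ x → u ≢ a → v ≢ x → v ≢ a → Adj G u x → Linked x a u v
      linked-adjacent {x} {a} {u} {v} x~a u≢v u≁v u≢x u≢a v≢x v≢a u~x with Adj? v x
      ... | no v≁x with hop v a
      ...   | W , in-W = inj₁ (link {walk₁ = step u~x stop} {walk₂ = W} λ where
              (here refl , u∈) → case in-W u∈ of λ where
                (inj₁ u≡v)              → u≢v u≡v
                (inj₂ (inj₁ u≡a))       → u≢a u≡a
                (inj₂ (inj₂ (v~u , _))) → u≁v (Adj-sym v~u)
              (there (here refl) , x∈) → case in-W x∈ of λ where
                (inj₁ x≡v)              → v≢x (≡.sym x≡v)
                (inj₂ (inj₁ x≡a))       → Adj⇒≢ x~a x≡a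
                (inj₂ (inj₂ (v~x , _))) → v≁x v~x)
      linked-adjacent {x} {a} {u} {v} x~a u≢v u≁v u≢x u≢a v≢x v≢a u~x | yes v~x with Adj? u a
      ...   | yes u~a = inj₂ (link {walk₁ = step u~a stop} {walk₂ = step v~x stop} λ where
                (here refl , here u≡v)                 → u≢v u≡v
                (here refl , there (here u≡x))         → u≢x u≡x
                (there (here refl) , here a≡v)         → v≢a (≡.sym a≡v)
                (there (here refl) , there (here a≡x)) → Adj⇒≢ x~a (≡.sym a≡x))
      -- Now `v` goes to `a` by way of a non-neighbour `w` of `x`. Both hops miss `x`, and they miss
      -- `u`, which differs from `w` and is adjacent to neither `v` nor `a`.
      ...   | no u≁a with nonneighbour x
      ...     | w , w≢x , x≁w with hop v w | hop w a
      ...       | W , in-W | W′ , in-W′ = inj₁ (link {walk₁ = step u~x stop} {walk₂ = W ++ʷ W′} λ where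
                    (here refl , u∈) → case ∈-++ʷ⁻ W W′ u∈ of λ where
                      (inj₁ u∈W) → case in-W u∈W of λ where
                        (inj₁ u≡v)              → u≢v u≡v
                        (inj₂ (inj₁ refl))      → x≁w (Adj-sym u~x)
                        (inj₂ (inj₂ (v~u , _))) → u≁v (Adj-sym v~u)
                      (inj₂ u∈W′) → case in-W′ u∈W′ of λ where
                        (inj₁ refl)             → x≁w (Adj-sym u~x)
                        (inj₂ (inj₁ u≡a))       → u≢a u≡a
                        (inj₂ (inj₂ (_ , u~a))) → u≁a u~a
                    (there (here refl) , x∈) → case ∈-++ʷ⁻ W W′ x∈ of λ where
                      (inj₁ x∈W) → case in-W x∈W of λ where
                        (inj₁ x≡v)              → v≢x (≡.sym x≡v)
                        (inj₂ (inj₁ x≡w))       → w≢x (≡.sym x≡w)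
                        (inj₂ (inj₂ (_ , x~w))) → x≁w x~w
                      (inj₂ x∈W′) → case in-W′ x∈W′ of λ where
                        (inj₁ x≡w)              → w≢x (≡.sym x≡w)
                        (inj₂ (inj₁ x≡a))       → Adj⇒≢ x~a x≡a
                        (inj₂ (inj₂ (w~x , _))) → x≁w (Adj-sym w~x))

      -- If u and v both reach the edge through the same vertex p, then one of them is
      -- rerouted through a non-neighbour w of p.
      linked-remote : ∀ {x a u v} → Adj G x a → u ≢ v → ¬ Adj G u v →
        u ≢ x → u ≢ a → v ≢ x → v ≢ a →
        ¬ Adj G u x → ¬ Adj G u a → ¬ Adj G v x → ¬ Adj G v a → Linked x a u v
      linked-remote {x} {a} {u} {v} x~a u≢v u≁v u≢x u≢a v≢x v≢a u≁x u≁a v≁x v≁a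
        with commonNeighbour u≢x u≁x | commonNeighbour v≢a v≁a
      ... | p , u~p , p~x | q , v~q , q~a with p ≟ q
      ...   | no p≢q = inj₁ (link {walk₁ = step u~p (step p~x stop)} {walk₂ = step v~q (step q~a stop)} λ where
              (here refl , here u≡v)                                 → u≢v u≡v
              (here refl , there (here refl))                        → u≁v (Adj-sym v~q)
              (here refl , there (there (here u≡a)))                 → u≢a u≡a
              (there (here refl) , here refl)                        → u≁v u~p
              (there (here refl) , there (here p≡q))                 → p≢q p≡q
              (there (here refl) , there (there (here refl)))        → u≁a u~p
              (there (there (here refl)) , here x≡v)                 → v≢x (≡.sym x≡v)
              (there (there (here refl)) , there (here refl))        → v≁x v~q
              (there (there (here refl)) , there (there (here x≡a))) → Adj⇒≢ x~a x≡a)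
      ...   | yes refl with nonneighbour p
      ...     | w , w≢p , p≁w with hop u w
      ...       | W , in-W = reroute
        where
        -- The neighbours `v`, `x`, `a` of `p` differ from `w` and are not adjacent to `u`, while
        -- `p` is not adjacent to `w`; so `W` misses all four.
        W-avoids-v : v ∉ vertices W
        W-avoids-v v∈ with in-W v∈
        ... | inj₁ v≡u              = u≢v (≡.sym v≡u)
        ... | inj₂ (inj₁ refl)      = p≁w (Adj-sym v~q)
        ... | inj₂ (inj₂ (u~v , _)) = u≁v u~v
        W-avoids-p : p ∉ vertices W
        W-avoids-p p∈ with in-W p∈
        ... | inj₁ p≡u              = Adj⇒≢ u~p (≡.sym p≡u)
        ... | inj₂ (inj₁ p≡w)       = w≢p (≡.sym p≡w)
        ... | inj₂ (inj₂ (_ , p~w)) = p≁w p~w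
        W-avoids-x : x ∉ vertices W
        W-avoids-x x∈ with in-W x∈
        ... | inj₁ x≡u              = u≢x (≡.sym x≡u)
        ... | inj₂ (inj₁ refl)      = p≁w p~x
        ... | inj₂ (inj₂ (u~x , _)) = u≁x u~x
        W-avoids-a : a ∉ vertices W
        W-avoids-a a∈ with in-W a∈
        ... | inj₁ a≡u              = u≢a (≡.sym a≡u)
        ... | inj₂ (inj₁ refl)      = p≁w q~a
        ... | inj₂ (inj₂ (u~a , _)) = u≁a u~a

        reroute : Linked x a u v
        reroute with Adj? w a
        ... | yes w~a = inj₂ (link {walk₁ = W ++ʷ step w~a stop} {walk₂ = step v~q (step p~x stop)}
                λ (t∈₁ , t∈₂) → case ∈-++ʷ⁻ W _ t∈₁ of λ where
                  (inj₁ t∈W) → case t∈₂ of λ where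
                    (here refl)                 → W-avoids-v t∈W
                    (there (here refl))         → W-avoids-p t∈W
                    (there (there (here refl))) → W-avoids-x t∈W
                  (inj₂ (here refl)) → case t∈₂ of λ where
                    (here refl)                 → p≁w (Adj-sym v~q)
                    (there (here refl))         → w≢p refl
                    (there (there (here refl))) → p≁w p~x
                  (inj₂ (there (here refl))) → case t∈₂ of λ where
                    (here refl)                 → v≢a refl
                    (there (here refl))         → ¬Adj-refl q~a
                    (there (there (here refl))) → ¬Adj-refl x~a)
        -- The hop misses `a` and `p`, non-neighbours of `w`, and `v`, a non-neighbour of `x`; so
        -- `u` can reach `x` while `v` goes through `p` to `a`.
        ... | no w≁a with hop w x
        ...   | W′ , in-W′ = inj₁ (link {walk₁ = W ++ʷ W′} {walk₂ = step v~q (step q~a stop)}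
                λ (t∈₁ , t∈₂) → case ∈-++ʷ⁻ W _ t∈₁ of λ where
                  (inj₁ t∈W) → case t∈₂ of λ where
                    (here refl)                 → W-avoids-v t∈W
                    (there (here refl))         → W-avoids-p t∈W
                    (there (there (here refl))) → W-avoids-a t∈W
                  (inj₂ t∈W′) → case t∈₂ of λ where
                    (here refl) → case in-W′ t∈W′ of λ where
                      (inj₁ refl)             → p≁w (Adj-sym v~q)
                      (inj₂ (inj₁ v≡x))       → v≢x v≡x
                      (inj₂ (inj₂ (_ , v~x))) → v≁x v~x
                    (there (here refl)) → case in-W′ t∈W′ of λ where
                      (inj₁ p≡w)              → w≢p (≡.sym p≡w)
                      (inj₂ (inj₁ p≡x))       → Adj⇒≢ p~x p≡x
                      (inj₂ (inj₂ (w~p , _))) → p≁w (Adj-sym w~p)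
                    (there (there (here refl))) → case in-W′ t∈W′ of λ where
                      (inj₁ refl)             → p≁w q~a
                      (inj₂ (inj₁ a≡x))       → Adj⇒≢ x~a (≡.sym a≡x)
                      (inj₂ (inj₂ (w~a , _))) → w≁a w~a)

      -- Exchanging `u` with `v`, or `x` with `a`, reduces everything to three cases: an end equal
      -- to `a`, an end adjacent to `x`, or no adjacency to the edge at all.
      linked : ∀ {x a u v} → Adj G x a → u ≢ v → ¬ Adj G u v → u ≢ x → v ≢ x → Linked x a u v
      linked {x} {a} {u} {v} x~a u≢v u≁v u≢x v≢x with u ≟ a | v ≟ a
      ... | yes refl | _        = linked-at x~a v≢x (≢-sym u≢v)
      ... | no _     | yes refl = Linked-swap (linked-at x~a u≢x u≢v)
      ... | no u≢a   | no v≢a with Adj? u x | Adj? v x | Adj? u a | Adj? v a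
      ...   | yes u~x | _ | _ | _ = linked-adjacent x~a u≢v u≁v u≢x u≢a v≢x v≢a u~x
      ...   | _ | yes v~x | _ | _ =
              Linked-swap (linked-adjacent x~a (≢-sym u≢v) (u≁v ∘ Adj-sym) v≢x v≢a u≢x u≢a v~x)
      ...   | _ | _ | yes u~a | _ =
              Linked-swapEdge (linked-adjacent (Adj-sym x~a) u≢v u≁v u≢a u≢x v≢a v≢x u~a)
      ...   | _ | _ | _ | yes v~a = Linked-swap (Linked-swapEdge
              (linked-adjacent (Adj-sym x~a) (≢-sym u≢v) (u≁v ∘ Adj-sym) v≢a v≢x u≢a u≢x v~a))
      ...   | no u≁x | no v≁x | no u≁a | no v≁a =
              linked-remote x~a u≢v u≁v u≢x u≢a v≢x v≢a u≁x u≁a v≁x v≁a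

      -- Three colours suffice without a universal vertex.

      nonuniversal⇒connectable : ∀ {x a} → Adj G x a → LooseConnectable G 3
      nonuniversal⇒connectable {x} {a} x~a = star , connects
        where
        g : V G → Fin 3
        g u with u ≟ a
        ... | yes _ = zero
        ... | no _  = suc zero

        g-a : g a ≡ zero
        g-a with a ≟ a
        ... | yes _  = refl
        ... | no a≢a = contradiction refl a≢a

        g-other : ∀ {u} → u ≢ a → g u ≡ suc zero
        g-other {u} u≢a with u ≟ a
        ... | yes u≡a = contradiction u≡a u≢a
        ... | no _    = refl

        g≢r : ∀ u → g u ≢ suc (suc zero)
        g≢r u with u ≟ a
        ... | yes _ = λ ()
        ... | no _  = λ ()

        ga≢g : ∀ {u} → u ≢ a → g a ≢ g u
        ga≢g u≢a eq with trans (≡.sym g-a) (trans eq (g-other u≢a))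
        ... | ()

        open StarColouring x g (suc (suc zero))

        -- Cut before its first visit to `x`, the walk to `x` ends in some `p`. As `a` lies on the
        -- other, disjoint walk, `p` is not `a`, so the path uses colours 1 and 0 at `x`.
        path-via-edge : ∀ {u v} → u ≢ x → v ≢ x → Linked x a u v → LoosePath star u v
        path-via-edge u≢x v≢x (inj₁ (link {W₁} {W₂} disjoint))
          with beforeHit W₁ u≢x | reverseʷ W₂
        ... | p , W₁′ , p~x , x∉W₁′ , W₁′⊆ | W₂′ , W₂′⊆ =
          through⇒loosePath W₁′ W₂′ x∉W₁′ (λ x∈ → disjoint (end-∈ W₁ , W₂′⊆ x∈))
            (λ (t∈₁ , t∈₂) → disjoint (W₁′⊆ t∈₁ , W₂′⊆ t∈₂)) p~x x~a
            (≢-sym (ga≢g (λ { refl → disjoint (W₁′⊆ (end-∈ W₁′) , end-∈ W₂) }))) (g≢r p) (g≢r a)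
        path-via-edge u≢x v≢x (inj₂ (link {W₁} {W₂} disjoint))
          with beforeHit W₂ v≢x
        ... | p , W₂′ , p~x , x∉W₂′ , W₂′⊆ with reverseʷ W₂′
        ...   | W₂″ , W₂″⊆ =
          through⇒loosePath W₁ W₂″ (λ x∈ → disjoint (x∈ , end-∈ W₂)) (x∉W₂′ ∘ W₂″⊆)
            (λ (t∈₁ , t∈₂) → disjoint (t∈₁ , W₂′⊆ (W₂″⊆ t∈₂))) (Adj-sym x~a) (Adj-sym p~x)
            (ga≢g (λ { refl → disjoint (end-∈ W₁ , W₂′⊆ (end-∈ W₂′)) })) (g≢r a) (g≢r p)

        connects : LooselyConnecting star
        connects u v u≢v with Adj? u v
        ... | yes u~v = edge⇒loosePath starColour starColour-sym u~v
        ... | no u≁v with u ≟ x | v ≟ x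
        ...   | no u≢x | no v≢x = path-via-edge u≢x v≢x (linked x~a u≢v u≁v u≢x v≢x)
        -- When `x` itself is an end, any path of two edges will do: its edge at `x` has colour 0 or
        -- 1, the other one colour 2.
        ...   | yes refl | _ with commonNeighbour u≢v u≁v
        ...     | m , x~m , m~v = cherry⇒loosePath starColour starColour-sym x~m m~v u≢v
                  λ eq → g≢r m (trans (≡.sym (starColour-from m))
                    (trans eq (starColour-off (Adj⇒≢ (Adj-sym x~m)) (≢-sym u≢v))))
        connects u v u≢v | no u≁v | no _ | yes refl with commonNeighbour u≢v u≁v
        ...     | m , u~m , m~x = cherry⇒loosePath starColour starColour-sym u~m m~x u≢v
                  λ eq → g≢r m (trans (≡.sym (starColour-to m))
                    (trans (≡.sym eq) (starColour-off u≢v (Adj⇒≢ m~x))))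

  -- Leaves, bridges and lower bounds.

  lastEdge : ∀ b ms v → All (λ p → Adj G (proj₁ p) (proj₂ p)) (pairs (b ∷ ms ++ v ∷ [])) →
    Σ (V G) λ z → z ∈ b ∷ ms × (z , v) ∈ pairs (b ∷ ms ++ v ∷ []) × Adj G z v
  lastEdge b []       v (e ∷ []) = b , here refl , here refl , e
  lastEdge b (m ∷ ms) v (_ ∷ es) with lastEdge m ms v es
  ... | z , z∈ , zv∈ , z~v = z , there z∈ , there zv∈ , z~v

  -- The last edge of any path to `y` must come from `x`, the only neighbour of `y`.
  leaf⇒bridge : ∀ {x y} → Leaf x y → IsBridge G x y
  leaf⇒bridge {x} {y} (x~y , only) = x~y , λ (P , xy∉ , _) → avoid P xy∉
    where
    avoid : (P : Path G x y) → ¬ ((x , y) ∉ pairs (Path.verts P))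
    avoid P xy∉ with lastEdge x (Path.mid P) y (Path.edges P)
    ... | z , _ , zy∈ , z~y = xy∉ (subst (λ t → (t , y) ∈ pairs (Path.verts P)) (only z (Adj-sym z~y)) zy∈)

  leafDegree : ∀ {x d} → d ≤ length (leaves x) → BridgeDegAtLeast G x d
  leafDegree {x} {d} d≤ℓ =
      (λ i → List.lookup (leaves x) (inject≤ i d≤ℓ))
    , (λ eq → inject≤-injective d≤ℓ d≤ℓ _ _ (leaves-distinct x eq))
    , λ i → leaf⇒bridge (leaves-lookup x (inject≤ i d≤ℓ))

  module _ {k : ℕ} (φ : EdgeColouring G k) where
    open EdgeColouring φ

    -- A path between the leaves has `x` both second and second to last. Vertices do not repeat, so
    -- it is `y`, `x`, `z`, and looseness separates its two colours.
    leaves-coloured-apart : ∀ {x y z} → y ≢ z → (ly : Leaf x y) (lz : Leaf x z) → LoosePath φ y z →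
      col x y (proj₁ ly) ≢ col x z (proj₁ lz)
    leaves-coloured-apart y≢z (x~y , only-y) (x~z , only-z) (record { mid = [] ; edges = e ∷ [] } , _) _
      with only-y _ e
    ... | refl = ¬Adj-refl x~z
    leaves-coloured-apart y≢z (x~y , only-y) (x~z , only-z)
      (record { mid = _ ∷ [] ; edges = e ∷ f ∷ [] } , distinct) eq with only-y _ e
    ... | refl = distinct (trans (colSym _ _ e x~y) (trans eq (cong (col _ _) (T-irrelevant x~z f))))
    leaves-coloured-apart {x} {z = z} y≢z (x~y , only-y) (x~z , only-z)
      (record { mid = m ∷ m′ ∷ ms ; unique = _ ∷ m∉ ∷ _ ; edges = e ∷ _ ∷ es } , _) _
      with only-y _ e | lastEdge m′ ms z es
    ... | refl | w , w∈ , _ , w~z with only-z w (Adj-sym w~z)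
    ...   | refl = All.lookup m∉ (∈-++⁺ˡ w∈) refl

    loose-monochromatic : (∀ (a b : Fin k) → a ≡ b) → ∀ {u v} → LoosePath φ u v → Adj G u v
    loose-monochromatic mono (record { mid = [] ; edges = e ∷ [] } , _) = e
    loose-monochromatic mono (record { mid = _ ∷ [] ; edges = _ ∷ _ ∷ [] } , a≢b) = contradiction (mono _ _) a≢b
    -- Longer paths are split once more, since `pairs` exposes a third edge only when the rest of
    -- `mid` is known to be empty or not.
    loose-monochromatic mono
      (record { mid = _ ∷ _ ∷ [] ; edges = _ ∷ _ ∷ _ ∷ [] } , _ , _ , _ , _ , _ , _ , a≢b , _) =
      contradiction (mono _ _) a≢b
    loose-monochromatic mono
      (record { mid = _ ∷ _ ∷ _ ∷ _ ; edges = _ ∷ _ ∷ _ ∷ _ } , _ , _ , _ , _ , _ , _ , a≢b , _) =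
      contradiction (mono _ _) a≢b

  leaves≤connectable : ∀ {x ℓ k} (f : Fin ℓ → V G) → Injective _≡_ _≡_ f → (∀ i → Leaf x (f i)) →
    LooseConnectable G k → ℓ ≤ k
  leaves≤connectable {x} f f-inj leaf (φ , connects) =
    injective⇒≤ {f = λ i → EdgeColouring.col φ x (f i) (proj₁ (leaf i))} λ {i} {j} eq →
      decidable-stable (i ≟ j) λ i≢j → leaves-coloured-apart φ (i≢j ∘ f-inj) (leaf i) (leaf j)
        (connects (f i) (f j) (i≢j ∘ f-inj)) eq

  2≤connectable : ∀ {k} → ¬ Complete G → LooseConnectable G k → 2 ≤ k
  2≤connectable {zero}        ¬complete (φ , connects) =
    contradiction (λ u v u≢v → loose-monochromatic φ (λ ()) (connects u v u≢v)) ¬complete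
  2≤connectable {suc zero}    ¬complete (φ , connects) =
    contradiction (λ u v u≢v → loose-monochromatic φ (λ { zero zero → refl }) (connects u v u≢v)) ¬complete
  2≤connectable {suc (suc _)} _ _ = s≤s (s≤s z≤n)

  -- Complete graphs.

  twoVertices : 2 ≤ n G → Σ (V G) λ u → Σ (V G) λ v → u ≢ v
  twoVertices 2≤n = inject≤ zero 2≤n , inject≤ (suc zero) 2≤n ,
    λ eq → case inject≤-injective 2≤n 2≤n zero (suc zero) eq of λ ()

  complete⇒lec≡1 : 2 ≤ n G → Complete G → IsLec G 1
  complete⇒lec≡1 2≤n complete =
      (colouring (λ _ _ → zero) (λ _ _ → refl) , λ u v u≢v → edge⇒loosePath _ _ (complete u v u≢v))
    , lower
    where
    lower : ∀ k → LooseConnectable G k → 1 ≤ k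
    lower (suc _) _       = s≤s z≤n
    -- Two distinct vertices span an edge, which has no colour in `Fin 0`.
    lower zero    (φ , _) with twoVertices 2≤n
    ... | u , v , u≢v = case EdgeColouring.col φ u v (complete u v u≢v) of λ ()

  -- Deciding whether two colours suffice.

  -- A 2-colouring is encoded as a set of ordered pairs, symmetrised by ∨ so that every set
  -- encodes one; this makes their existence decidable by anySubset?.
  bit : Subset (n G * n G) → V G → V G → Bool
  bit s u v = lookup s (combine u v) ∨ lookup s (combine v u)

  -- With only two colours, a loose path has one edge or two edges of different colours.
  Good : Subset (n G * n G) → Set
  Good s = ∀ u v → u ≡ v ⊎ Adj G u v ⊎ ∃ λ w → Adj G u w × Adj G w v × bit s u w ≢ bit s w v

  good? : ∀ s → Dec (Good s)
  good? s = all? λ u → all? λ v → (u ≟ v) ⊎-dec (Adj? u v ⊎-dec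
    any? λ w → Adj? u w ×-dec (Adj? w v ×-dec ¬? (bit s u w Bool.≟ bit s w v)))

  good⇒connectable : ∀ s → Good s → LooseConnectable G 2
  good⇒connectable s good = colouring c c-sym , connects
    where
    toFin : Bool → Fin 2
    toFin false = zero
    toFin true  = suc zero

    toFin-injective : Injective _≡_ _≡_ toFin
    toFin-injective {false} {false} _ = refl
    toFin-injective {true}  {true}  _ = refl

    c : V G → V G → Fin 2
    c u v = toFin (bit s u v)

    c-sym : ∀ u v → c u v ≡ c v u
    c-sym u v = cong toFin (∨-comm (lookup s (combine u v)) _)

    connects : LooselyConnecting (colouring c c-sym)
    connects u v u≢v with good u v
    ... | inj₁ u≡v                               = contradiction u≡v u≢v
    ... | inj₂ (inj₁ u~v)                        = edge⇒loosePath c c-sym u~v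
    ... | inj₂ (inj₂ (w , u~w , w~v , distinct)) =
            cherry⇒loosePath c c-sym u~w w~v u≢v (distinct ∘ toFin-injective)

  connectable⇒good : LooseConnectable G 2 → ∃ Good
  connectable⇒good (φ , connects) = s , good
    where
    open EdgeColouring φ

    toBool : Fin 2 → Bool
    toBool zero    = false
    toBool (suc _) = true

    toBool-injective : Injective _≡_ _≡_ toBool
    toBool-injective {zero}     {zero}     _ = refl
    toBool-injective {suc zero} {suc zero} _ = refl

    entry : (p : V G × V G) → Dec (Adj G (proj₁ p) (proj₂ p)) → Bool
    entry p (yes e) = toBool (col _ _ e)
    -- A default for pairs without an edge; `bit-s` compares bits with colours on edges only.
    entry p (no _)  = false

    entry-edge : ∀ {u v} (e : Adj G u v) d → entry (u , v) d ≡ toBool (col u v e)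
    entry-edge e (yes e′) = cong (toBool ∘ col _ _) (T-irrelevant e′ e)
    entry-edge e (no ≁)   = contradiction e ≁

    table : V G × V G → Bool
    table p = entry p (Adj? (proj₁ p) (proj₂ p))

    s : Subset (n G * n G)
    s = tabulate (table ∘ remQuot (n G))

    lookup-s : ∀ {u v} (e : Adj G u v) → lookup s (combine u v) ≡ toBool (col u v e)
    lookup-s {u} {v} e = trans (lookup∘tabulate (table ∘ remQuot (n G)) (combine u v))
      (trans (cong table (remQuot-combine u v)) (entry-edge e (Adj? u v)))

    -- By `colSym` both orders of the pair store the same bit, so the disjunction collapses.
    bit-s : ∀ {u v} (e : Adj G u v) → bit s u v ≡ toBool (col u v e)
    bit-s {u} {v} e = trans
      (cong₂ _∨_ (lookup-s e) (trans (lookup-s (Adj-sym e)) (cong toBool (colSym v u (Adj-sym e) e))))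
      (∨-idem _)

    fromPath : ∀ {u v} → LoosePath φ u v → Adj G u v ⊎ ∃ λ w → Adj G u w × Adj G w v × bit s u w ≢ bit s w v
    fromPath (record { mid = [] ; edges = e ∷ [] } , _) = inj₁ e
    fromPath (record { mid = m ∷ [] ; edges = e ∷ f ∷ [] } , distinct) = inj₂ (m , e , f ,
      λ eq → distinct (toBool-injective (trans (≡.sym (bit-s e)) (trans eq (bit-s f)))))
    fromPath (record { mid = _ ∷ _ ∷ [] ; edges = _ ∷ _ ∷ _ ∷ [] } , _ , _ , _ , _ , _ , _ , a≢b , a≢c , b≢c) =
      ⊥-elim (fin2-pigeonhole a≢b a≢c b≢c)
    fromPath (record { mid = _ ∷ _ ∷ _ ∷ _ ; edges = _ ∷ _ ∷ _ ∷ _ } , _ , _ , _ , _ , _ , _ , a≢b , a≢c , b≢c) =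
      ⊥-elim (fin2-pigeonhole a≢b a≢c b≢c)

    good : Good s
    good u v with u ≟ v
    ... | yes u≡v = inj₁ u≡v
    ... | no u≢v  = inj₂ (fromPath (connects u v u≢v))

  -- Needed to name the exact value of lec constructively when three colours are known to suffice:
  -- it is 2 or 3.
  connectable₂? : Dec (LooseConnectable G 2)
  connectable₂? = map′ (λ (s , good) → good⇒connectable s good) connectable⇒good (anySubset? good?)

  -- The value of lec for incomplete graphs of diameter two.

  module _ (2≤n : 2 ≤ n G) (diam : DiamAtMost2 G) (¬complete : ¬ Complete G) where

    LecBound : Set
    LecBound = Σ ℕ λ m → IsLec G m × 2 ≤ m × (∀ d → IsMaxCutDeg G d → m ≤ 3 ⊔ d)

    connectable₃⇒lecBound : LooseConnectable G 3 → LecBound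
    connectable₃⇒lecBound conn₃ with connectable₂?
    ... | yes conn₂ = 2 , (conn₂ , λ _ → 2≤connectable ¬complete) , ≤-refl
            , λ d _ → ≤-trans (s≤s (s≤s z≤n)) (m≤m⊔n 3 d)
    ... | no ¬conn₂ = 3 , (conn₃ , lower) , s≤s (s≤s z≤n) , λ d _ → m≤m⊔n 3 d
      where
      lower : ∀ k → LooseConnectable G k → 3 ≤ k
      lower k conn = ≤∧≢⇒< (2≤connectable ¬complete conn) λ { refl → ¬conn₂ conn }

    lecBound : LecBound
    lecBound with any? universal?
    ... | no ¬univ = connectable₃⇒lecBound
            (nonuniversal⇒connectable diam (λ x univ → ¬univ (x , univ)) (proj₂ (proj₂ edge)))
      where
      edge : Σ (V G) λ x → Σ (V G) λ a → Adj G x a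
      edge with twoVertices 2≤n
      ... | u , v , u≢v with diam u v
      ...   | inj₁ u≡v                  = contradiction u≡v u≢v
      ...   | inj₂ (inj₁ u~v)           = u , v , u~v
      ...   | inj₂ (inj₂ (w , u~w , _)) = u , w , u~w
    ... | yes (x , univ) with 3 ≤? length (leaves x)
    ...   | no 3≰ℓ = connectable₃⇒lecBound (universal⇒connectable univ ≤-refl (<⇒≤ (≰⇒> 3≰ℓ)))
    ...   | yes 3≤ℓ = ℓ
              , (universal⇒connectable univ 3≤ℓ ≤-refl , λ _ → leaves≤connectable (List.lookup (leaves x))
                  (leaves-distinct x) (leaves-lookup x))
              , ≤-trans (s≤s (s≤s z≤n)) 3≤ℓ
              -- If `d` were less than `ℓ`, then `suc d` of the leaves would give as many bridges at
              -- `x`, against the maximality of `d`.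
              , λ d (_ , max) → ≤-trans (≮⇒≥ (λ d<ℓ → max x (leafDegree d<ℓ))) (m≤n⊔m 3 d)
      where
      ℓ : ℕ
      ℓ = length (leaves x)

-- Stars attain the bounds.

Star : ℕ → Graph
Star k = record { n = suc k ; adj = adjacent ; sym = symmetric ; irrefl = irreflexive }
  where
  adjacent : Fin (suc k) → Fin (suc k) → Bool
  adjacent zero    zero    = false
  adjacent zero    (suc _) = true
  adjacent (suc _) zero    = true
  adjacent (suc _) (suc _) = false

  symmetric : ∀ u v → adjacent u v ≡ adjacent v u
  symmetric zero    zero    = refl
  symmetric zero    (suc _) = refl
  symmetric (suc _) zero    = refl
  symmetric (suc _) (suc _) = refl

  irreflexive : ∀ v → adjacent v v ≡ false
  irreflexive zero    = refl
  irreflexive (suc _) = refl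

module _ {k : ℕ} where

  star-leaf : (i : Fin k) → Leaf (Star k) zero (suc i)
  star-leaf i = tt , λ { zero _ → refl }

  star-connectable : LooseConnectable (Star k) k
  star-connectable = φ , connects
    where
    φ : EdgeColouring (Star k) k
    φ = record
      { col    = λ { zero (suc i) _ → i ; (suc i) zero _ → i }
      ; colSym = λ { zero (suc _) _ _ → refl ; (suc _) zero _ _ → refl }
      }

    connects : LooselyConnecting φ
    connects zero    zero    u≢v = contradiction refl u≢v
    connects zero    (suc j) u≢v = record { mid = [] ; unique = (u≢v ∷ []) ∷ [] ∷ [] ; edges = tt ∷ [] } , tt
    connects (suc i) zero    u≢v = record { mid = [] ; unique = (u≢v ∷ []) ∷ [] ∷ [] ; edges = tt ∷ [] } , tt
    connects (suc i) (suc j) u≢v =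
        record { mid = zero ∷ [] ; unique = ((λ ()) ∷ u≢v ∷ []) ∷ ((λ ()) ∷ []) ∷ [] ∷ [] ; edges = tt ∷ tt ∷ [] }
      , u≢v ∘ cong suc

  star-diam : DiamAtMost2 (Star k)
  star-diam zero    zero    = inj₁ refl
  star-diam zero    (suc _) = inj₂ (inj₁ tt)
  star-diam (suc _) zero    = inj₂ (inj₁ tt)
  star-diam (suc _) (suc _) = inj₂ (inj₂ (zero , tt , tt))

  star-lec : IsLec (Star k) k
  star-lec = star-connectable , λ _ → leaves≤connectable (Star k) suc (λ { refl → refl }) star-leaf

  star-maxCutDeg : IsMaxCutDeg (Star k) k
  star-maxCutDeg =
      (zero , suc , (λ { refl → refl }) , λ i → leaf⇒bridge (Star k) (star-leaf i))
    -- All `suc k` bridge neighbours differ from `v`; punching `v` out of the `suc k` vertices would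
    -- inject them into `Fin k`.
    , λ v (f , f-inj , bridge) → 1+n≰n (injective⇒≤
        {f = λ i → punchOut (Adj⇒≢ (Star k) (proj₁ (bridge i)))}
        λ {i} {j} eq → f-inj (punchOut-injective
          (Adj⇒≢ (Star k) (proj₁ (bridge i))) (Adj⇒≢ (Star k) (proj₁ (bridge j))) eq))

star-incomplete : ∀ {k} → 2 ≤ k → ¬ Complete (Star k)
star-incomplete (s≤s (s≤s _)) complete = complete (suc zero) (suc (suc zero)) λ ()

star-extremal : ∀ {k} → 2 ≤ k →
  2 ≤ n (Star k) × Connected (Star k) × DiamAtMost2 (Star k) × ¬ Complete (Star k) × IsLec (Star k) k
star-extremal 2≤k =
    m≤n⇒m≤1+n 2≤k
  , (λ u v u≢v → proj₁ (proj₂ star-connectable u v u≢v))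
  , star-diam
  , star-incomplete 2≤k
  , star-lec

theorem4 : ((G : Graph) → 2 ≤ n G → Connected G → DiamAtMost2 G →
    (Complete G → IsLec G 1)
    × (¬ Complete G →
    Σ ℕ λ m → IsLec G m × 2 ≤ m
    × (∀ d → IsMaxCutDeg G d → m ≤ 3 ⊔ d)))
    × (Σ Graph λ G → 2 ≤ n G × Connected G × DiamAtMost2 G × ¬ Complete G
    × IsLec G 2)
    × (Σ Graph λ G → 2 ≤ n G × Connected G × DiamAtMost2 G × ¬ Complete G
    × IsLec G 3)
    × (∀ k → 4 ≤ k →
    Σ Graph λ G → 2 ≤ n G × Connected G × DiamAtMost2 G × ¬ Complete G
    × IsLec G k × IsMaxCutDeg G k)
theorem4 =
    (λ G 2≤n _ diam → complete⇒lec≡1 G 2≤n , lecBound G 2≤n diam)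
  , (Star 2 , star-extremal (s≤s (s≤s z≤n)))
  , (Star 3 , star-extremal (s≤s (s≤s z≤n)))
  , λ k 4≤k → case star-extremal (≤-trans (s≤s (s≤s z≤n)) 4≤k) of λ
      (2≤n , conn , diam , ¬complete , lec) → Star k , 2≤n , conn , diam , ¬complete , lec , star-maxCutDeg
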